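{- For any integer $n\geq 2$, $W_{c}\left(Q_{n}\right)\geq 4(n-1)$.
   Context: $Q_{n}$ is the $n$-dimensional hypercube graph, with vertex set $\{0,1\}^{n}$, two vertices being adjacent if and only if they differ in exactly one coordinate. For a finite simple graph $G$ and a positive integer $t$, an interval cyclic $t$-coloring of $G$ is a proper edge-coloring of $G$ with colors $1,\ldots,t$ such that all $t$ colors are used and, for each vertex $v$, the edges incident to $v$ are colored by $d_{G}(v)$ consecutive colors modulo $t$ (i.e. consecutive in the cyclic order $1,2,\ldots,t,1$), where $d_G(v)$ is the degree of $v$. For a graph $G$ having an interval cyclic $t$-coloring for some positive integer $t$, $W_{c}(G)$ is the greatest such $t$. (Every hypercube $Q_n$, $n\ge 1$, has such a coloring.) -}

module Defs where

open import Data.Bool.Base using (Bool; true; false)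
import Data.Bool.Properties as Bool
open import Data.Fin.Base using (Fin; toℕ)
import Data.Fin.Properties as Fin
open import Data.List.Base using (List; []; _∷_; cartesianProductWith; filter; length)
open import Data.List.Membership.Propositional using (_∈_)
open import Data.List.Membership.Propositional.Properties
  using (∈-cartesianProductWith⁺)
open import Data.List.Relation.Unary.All using ([]; _∷_)
open import Data.List.Relation.Unary.AllPairs using ([]; _∷_)
open import Data.List.Relation.Unary.Any using (here; there)
open import Data.List.Relation.Unary.Unique.Propositional using (Unique)
open import Data.List.Relation.Unary.Unique.Propositional.Properties
  using (cartesianProductWith⁺)
open import Data.Nat.Base using (ℕ; zero; suc; _+_; _%_; _≤_; _<_; NonZero)
open import Data.Product.Base using (_×_; _,_; ∃-syntax; Σ-syntax)
open import Data.Product using (∃!)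
open import Data.Vec.Base using (Vec; []; _∷_; lookup)
open import Data.Vec.Properties using (∷-injective)
open import Function.Base using (_∘_)
open import Function.Bundles using (_⇔_)
open import Relation.Binary.Definitions using (Decidable; Symmetric)
open import Relation.Binary.PropositionalEquality.Core
  using (_≡_; _≢_; refl; sym)
open import Relation.Nullary.Decidable using (map′; _×-dec_; _→-dec_; ¬?)
open import Relation.Nullary.Negation using (¬_)

record FiniteSimpleGraph : Set₁ where
  field
    Vertex    : Set
    Adj       : Vertex → Vertex → Set
    adj?      : Decidable Adj
    adj-sym   : Symmetric Adj
    adj-irr   : ∀ {v} → ¬ Adj v v
    vertices  : List Vertex
    complete  : ∀ v → v ∈ vertices
    unique    : Unique vertices

  degree : Vertex → ℕ
  degree v = length (filter (adj? v) vertices)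

module _ (G : FiniteSimpleGraph) where
  open FiniteSimpleGraph G

  -- The colors 1, …, t are represented by 0, …, t − 1.  An edge is given by an
  -- ordered pair of adjacent vertices; the irrelevant adjacency argument and
  -- color-sym make the color a function of the unordered edge.
  record IntervalCyclicColoring (t : ℕ) : Set where
    field
      {{positive}} : NonZero t
      color        : (u v : Vertex) → .(Adj u v) → Fin t
      color-sym    : ∀ {u v} (e : Adj u v) → color u v e ≡ color v u (adj-sym e)
      proper       : ∀ {u v w} (e : Adj u v) (f : Adj u w) →
                     v ≢ w → color u v e ≢ color u w f
      allUsed      : ∀ k → ∃[ u ] ∃[ v ] Σ[ e ∈ Adj u v ] color u v e ≡ k
      consecutive  : ∀ v → ∃[ a ] ∀ k →
                     (∃[ w ] Σ[ e ∈ Adj v w ] color v w e ≡ k) ⇔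
                     (∃[ i ] i < degree v × toℕ k ≡ (a + i) % t)

  record IsW-c (w : ℕ) : Set where
    field
      attained : IntervalCyclicColoring w
      greatest : ∀ t → IntervalCyclicColoring t → t ≤ w

DifferInExactlyOne : ∀ {n} → Vec Bool n → Vec Bool n → Set
DifferInExactlyOne u v = ∃! _≡_ λ i → lookup u i ≢ lookup v i

differInExactlyOne? : ∀ {n} → Decidable (DifferInExactlyOne {n})
differInExactlyOne? u v =
  map′ (λ (i , d , only) → i , d , λ {j} → only j)
       (λ (i , d , only) → i , d , λ j → only {j})
       (Fin.any? λ i → differ? i ×-dec Fin.all? λ j → differ? j →-dec (i Fin.≟ j))
  where differ? = λ i → ¬? (lookup u i Bool.≟ lookup v i)

bits : List Bool
bits = false ∷ true ∷ []

bits-complete : ∀ b → b ∈ bits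
bits-complete false = here refl
bits-complete true  = there (here refl)

bits-unique : Unique bits
bits-unique = ((λ ()) ∷ []) ∷ [] ∷ []

cube : ∀ n → List (Vec Bool n)
cube zero    = [] ∷ []
cube (suc n) = cartesianProductWith _∷_ bits (cube n)

cube-complete : ∀ {n} (v : Vec Bool n) → v ∈ cube n
cube-complete []      = here refl
cube-complete (b ∷ v) =
  ∈-cartesianProductWith⁺ _∷_ (bits-complete b) (cube-complete v)

cube-unique : ∀ n → Unique (cube n)
cube-unique zero    = [] ∷ []
cube-unique (suc n) = cartesianProductWith⁺ _∷_ ∷-injective bits-unique (cube-unique n)

Q : ℕ → FiniteSimpleGraph
Q n = record
  { Vertex   = Vec Bool n
  ; Adj      = DifferInExactlyOne
  ; adj?     = differInExactlyOne?
  ; adj-sym  = λ (i , d , only) → i , d ∘ sym , λ d′ → only (d′ ∘ sym)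
  ; adj-irr  = λ (_ , d , _) → d refl
  ; vertices = cube n
  ; complete = cube-complete
  ; unique   = cube-unique n
  }

{-# OPTIONS --safe #-}
module Submission where

-- Two independent facts give the theorem.
--
-- The lower bound is an explicit coloring of Q n with t = 4d colors, where
-- d = n - 1.  View Q n as the product of the 4-cycle on the first two
-- coordinates with the cube on the remaining n - 2, and number the vertices of
-- the 4-cycle 0, 1, 2, 3 in cyclic order.  A vertex over position q uses the n
-- consecutive colors qd, qd + 1, ..., qd + d modulo 4d: the cycle edge from
-- the preceding position gets qd, the cycle edge to the next position gets
-- (q + 1)d, and an edge in one of the other n - 2 directions gets a color
-- strictly between, determined by its direction.  The two ends of an edge
-- agree on its color (colorNumber-flip), and since every vertex meets all
-- the colors of its window (rank-surjective), the four windows cover all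
-- colors.
--
-- That a greatest t exists needs a constructive argument, since a bounded
-- inhabited set of numbers need not have a computable maximum unless membership
-- is decidable.  In any finite graph t is at most the number of ordered pairs of
-- vertices, as distinct colors occur on distinct pairs (colors-bounded); and
-- for each t the existence of a coloring is decidable (colorable?), by
-- searching the finitely many maps from ordered pairs of vertices to colors.
-- A downward search from the bound then finds the maximum (greatest-exists).

open import Defs
open import Data.Bool.Base using (Bool; true; false; not; _xor_)
import Data.Bool.Properties as Bool
open import Data.Empty using (⊥-elim)
open import Data.Fin.Base
  using (Fin; zero; suc; toℕ; fromℕ; fromℕ<; inject₁; combine; remQuot; finToFun; funToFin)
import Data.Fin.Properties as Fin
open import Data.Fin.Relation.Unary.Top using (view; ‵fromℕ; ‵inject₁)
open import Data.List.Base using (map; filter; length; allFin; lookup)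
open import Data.List.Properties using (length-map; length-tabulate)
open import Data.List.Membership.Propositional using (_∈_)
open import Data.List.Membership.Propositional.Properties
  using (∈-map⁺; ∈-map⁻; ∈-filter⁺; ∈-filter⁻; ∈-allFin)
open import Data.List.Membership.Propositional.Properties.WithK using (unique∧set⇒bag)
open import Data.List.Relation.Binary.BagAndSetEquality using (∼bag⇒↭)
open import Data.List.Relation.Binary.Permutation.Propositional.Properties using (↭-length)
import Data.List.Relation.Unary.Any as Any
open import Data.List.Relation.Unary.Any.Properties using (lookup-index)
open import Data.List.Relation.Unary.Unique.Propositional.Properties
  using (map⁺; filter⁺; allFin⁺)
open import Data.Nat.Base
  using (ℕ; zero; suc; pred; _+_; _*_; _^_; _∸_; _%_; _≤_; _<_; s≤s; z≤n; NonZero)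
open import Data.Nat.DivMod
  using (_mod_; m%n<n; m%n%n≡m%n; m<n⇒m%n≡m; [m+n]%n≡m%n; [m+kn]%n≡m%n; %-distribˡ-+)
import Data.Nat.Properties as ℕ
open import Data.Nat.Tactic.RingSolver using (solve-∀)
open import Data.Product.Base using (_×_; _,_; ∃; ∃-syntax; Σ-syntax; proj₁; proj₂; uncurry)
open import Data.Vec.Base as Vec using (Vec; []; _∷_; updateAt)
open import Data.Vec.Properties using (lookup∘updateAt; lookup∘updateAt′)
open import Function.Base using (_∘_)
open import Function.Bundles using (_⇔_; mk⇔; Equivalence)
open import Relation.Binary.Definitions using (DecidableEquality)
open import Relation.Binary.PropositionalEquality
  using (_≡_; _≢_; refl; sym; trans; cong; cong₂; subst; module ≡-Reasoning)
open import Relation.Nullary.Decidable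
  using (Dec; yes; no; map′; _×-dec_; _→-dec_; ¬?)
open import Relation.Nullary.Negation using (contradiction)
open import Relation.Unary using (Decidable)

-- Arithmetic modulo t and bounded maxima

%-absorbˡ-+ : ∀ a i t .{{_ : NonZero t}} → (a % t + i) % t ≡ (a + i) % t
%-absorbˡ-+ a i t = begin
  (a % t + i) % t          ≡⟨ %-distribˡ-+ (a % t) i t ⟩
  (a % t % t + i % t) % t  ≡⟨ cong (λ r → (r + i % t) % t) (m%n%n≡m%n a t) ⟩
  (a % t + i % t) % t      ≡⟨ %-distribˡ-+ a i t ⟨
  (a + i) % t              ∎
  where open ≡-Reasoning

-- Adding a * (t - 1) undoes the shift by a modulo t.
unshift : ∀ a {i} t .{{_ : NonZero t}} → i < t →
          i ≡ ((a * pred t) % t + (a + i) % t) % t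
unshift a {i} t@(suc p) i<t = begin
  i                                      ≡⟨ m<n⇒m%n≡m i<t ⟨
  i % t                                  ≡⟨ [m+kn]%n≡m%n i a t ⟨
  (i + a * suc p) % t                    ≡⟨ cong (_% t) (rearrange i a p) ⟩
  (a * p + (a + i)) % t                  ≡⟨ %-distribˡ-+ (a * p) (a + i) t ⟩
  ((a * p) % t + (a + i) % t) % t        ∎
  where
  open ≡-Reasoning
  rearrange : ∀ i a p → i + a * suc p ≡ a * p + (a + i)
  rearrange = solve-∀

shift-injective : ∀ a {i j} t .{{_ : NonZero t}} → i < t → j < t →
                  (a + i) % t ≡ (a + j) % t → i ≡ j
shift-injective a {i} {j} t i<t j<t eq = begin
  i                                       ≡⟨ unshift a t i<t ⟩
  ((a * pred t) % t + (a + i) % t) % t    ≡⟨ cong (λ r → ((a * pred t) % t + r) % t) eq ⟩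
  ((a * pred t) % t + (a + j) % t) % t    ≡⟨ unshift a t j<t ⟨
  j                                       ∎
  where open ≡-Reasoning

toℕ-mod : ∀ k t .{{_ : NonZero t}} → toℕ (k mod t) ≡ k % t
toℕ-mod k t = Fin.toℕ-fromℕ< (m%n<n k t)

bounded-max : ∀ {P : ℕ → Set} → Decidable P → ∀ b → (∀ t → P t → t ≤ b) →
              ∃ P → ∃[ w ] (P w × ∀ t → P t → t ≤ w)
bounded-max P? zero    bound (s , p) with z≤n ← bound s p = s , p , bound
bounded-max P? (suc b) bound p with P? (suc b)
... | yes q = suc b , q , bound
... | no ¬q = bounded-max P? b
  (λ t r → ℕ.≤-pred (ℕ.≤∧≢⇒< (bound t r) λ { refl → ¬q r })) p

_⇔-dec_ : ∀ {A B : Set} → Dec A → Dec B → Dec (A ⇔ B)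
a? ⇔-dec b? = map′ (uncurry mk⇔) (λ e → Equivalence.to e , Equivalence.from e)
                   ((a? →-dec b?) ×-dec (b? →-dec a?))

-- Interval cyclic colorings of a finite graph: bound and decidability

module _ (G : FiniteSimpleGraph) where
  open FiniteSimpleGraph G

  -- The number of vertices; vertices are identified with the numbers below it
  -- by their place in the enumeration.
  order : ℕ
  order = length vertices

  vertex : Fin order → Vertex
  vertex = lookup vertices

  index : Vertex → Fin order
  index v = Any.index (complete v)

  vertex-index : ∀ v → vertex (index v) ≡ v
  vertex-index v = sym (lookup-index (complete v))

  index-injective : ∀ {u v} → index u ≡ index v → u ≡ v
  index-injective {u} {v} eq =
    trans (sym (vertex-index u)) (trans (cong vertex eq) (vertex-index v))

  _≟ᵥ_ : DecidableEquality Vertex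
  u ≟ᵥ v = map′ index-injective (cong index) (index u Fin.≟ index v)

  anyVertex? : ∀ {P : Vertex → Set} → Decidable P → Dec (∃ P)
  anyVertex? {P} P? =
    map′ (λ (i , p) → vertex i , p)
         (λ (v , p) → index v , subst P (sym (vertex-index v)) p)
         (Fin.any? (P? ∘ vertex))

  allVertices? : ∀ {P : Vertex → Set} → Decidable P → Dec (∀ v → P v)
  allVertices? {P} P? =
    map′ (λ f v → subst P (vertex-index v) (f (index v)))
         (λ f i → f (vertex i))
         (Fin.all? (P? ∘ vertex))

  -- Sending each color to an ordered pair of vertices that carries it is
  -- injective.
  colors-bounded : ∀ t → IntervalCyclicColoring G t → t ≤ order * order
  colors-bounded t φ = Fin.injective⇒≤ {f = carrier} λ {k} {l} → carrier-injective k l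
    where
    open IntervalCyclicColoring φ

    carrier : Fin t → Fin (order * order)
    carrier k = let u , v , _ = allUsed k in combine (index u) (index v)

    carrier-injective : ∀ k l → carrier k ≡ carrier l → k ≡ l
    carrier-injective k l eq with allUsed k | allUsed l
    ... | u , v , _ , refl | u′ , v′ , _ , refl
      with refl ← index-injective (Fin.combine-injectiveˡ (index u) (index v) (index u′) (index v′) eq)
         | refl ← index-injective (Fin.combine-injectiveʳ (index u) (index v) (index u′) (index v′) eq)
      = refl

  module _ (t : ℕ) {{t≢0 : NonZero t}} where

    -- The conditions of an interval cyclic t-coloring, for a map that assigns
    -- a color to every ordered pair of vertices; its values at non-adjacent
    -- pairs are unconstrained.  The first color of each window is taken below
    -- t, so that all the quantifiers are bounded.
    Valid : (Vertex → Vertex → Fin t) → Set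
    Valid c =
        (∀ u v → Adj u v → c u v ≡ c v u)
      × (∀ u v w → Adj u v → Adj u w → v ≢ w → c u v ≢ c u w)
      × (∀ k → ∃[ u ] ∃[ v ] (Adj u v × c u v ≡ k))
      × (∀ v → ∃[ a ] (a < t × ∀ k →
           (∃[ w ] (Adj v w × c v w ≡ k)) ⇔
           (∃[ i ] (i < degree v × toℕ k ≡ (a + i) % t))))

    valid? : Decidable Valid
    valid? c =
            (allVertices? λ u → allVertices? λ v → adj? u v →-dec (c u v Fin.≟ c v u))
      ×-dec (allVertices? λ u → allVertices? λ v → allVertices? λ w →
               adj? u v →-dec adj? u w →-dec ¬? (v ≟ᵥ w) →-dec ¬? (c u v Fin.≟ c u w))
      ×-dec (Fin.all? λ k → anyVertex? λ u → anyVertex? λ v →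
               adj? u v ×-dec (c u v Fin.≟ k))
      ×-dec (allVertices? λ v → ℕ.anyUpTo? (λ a → Fin.all? λ k →
               (anyVertex? λ w → adj? v w ×-dec (c v w Fin.≟ k)) ⇔-dec
               ℕ.anyUpTo? (λ i → toℕ k ℕ.≟ (a + i) % t) (degree v)) t)

    Valid⇒coloring : ∀ {c} → Valid c → IntervalCyclicColoring G t
    Valid⇒coloring {c} (symm , prop , used , window) = record
      { color       = λ u v _ → c u v
      ; color-sym   = λ e → symm _ _ e
      ; proper      = λ e f → prop _ _ _ e f
      ; allUsed     = used
      ; consecutive = λ v → let a , _ , w = window v in a , w
      }

    -- A coloring carries its own proof that t is nonzero; passing t≢0 explicitly
    -- keeps unification from choosing that proof, and the two agree only up to
    -- irrelevance.
    coloring⇒Valid : (φ : IntervalCyclicColoring G t) → ∀ {c} →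
                     (∀ u v (e : Adj u v) → c u v ≡ IntervalCyclicColoring.color φ u v e) →
                     Valid c
    coloring⇒Valid φ {c} agree =
        (λ u v e → trans (agree u v e) (trans (color-sym e) (sym (agree v u (adj-sym e)))))
      , (λ u v w e f v≢w eq →
           proper e f v≢w (trans (sym (agree u v e)) (trans eq (agree u w f))))
      , (λ k → let u , v , e , eq = allUsed k in u , v , e , trans (agree u v e) eq)
      , λ v → let a , window = consecutive v in
          _%_ a t {{t≢0}} , m%n<n a t {{t≢0}} , λ k → mk⇔
            (λ (w , e , eq) →
               let i , i< , k≡ = Equivalence.to (window k) (w , e , trans (sym (agree v w e)) eq)
               in i , i< , trans k≡ (sym (%-absorbˡ-+ a i t {{t≢0}})))
            (λ (i , i< , k≡) →
               let w , e , eq = Equivalence.from (window k) (i , i< ,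
                              trans k≡ (%-absorbˡ-+ a i t {{t≢0}}))
               in w , e , trans (agree v w e) eq)
      where open IntervalCyclicColoring φ hiding (positive)

    -- Maps from ordered pairs of vertices to colors, coded by numbers.
    Code : Set
    Code = Fin (t ^ (order * order))

    decode : Code → Vertex → Vertex → Fin t
    decode x u v = finToFun x (combine (index u) (index v))

    onPairs : (Vertex → Vertex → Fin t) → Fin (order * order) → Fin t
    onPairs c p = let i , j = remQuot {order} order p in c (vertex i) (vertex j)

    encode : (Vertex → Vertex → Fin t) → Code
    encode c = funToFin (onPairs c)

    decode-encode : ∀ c u v → decode (encode c) u v ≡ c u v
    decode-encode c u v = begin
      decode (encode c) u v
        ≡⟨ Fin.finToFun-funToFin (onPairs c) (combine (index u) (index v)) ⟩
      onPairs c (combine (index u) (index v))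
        ≡⟨ cong (λ (i , j) → c (vertex i) (vertex j)) (Fin.remQuot-combine (index u) (index v)) ⟩
      c (vertex (index u)) (vertex (index v))
        ≡⟨ cong₂ c (vertex-index u) (vertex-index v) ⟩
      c u v ∎
      where open ≡-Reasoning

    -- The colors of a coloring, with color 0 at non-adjacent pairs.
    extend : IntervalCyclicColoring G t → Vertex → Vertex → Fin t
    extend φ u v with adj? u v
    ... | yes e = IntervalCyclicColoring.color φ u v e
    ... | no  _ = 0 mod t

    extend-color : ∀ φ u v (e : Adj u v) →
                   extend φ u v ≡ IntervalCyclicColoring.color φ u v e
    extend-color φ u v e with adj? u v
    ... | yes _ = refl
    ... | no ¬e = contradiction e ¬e

    colorableNonZero? : Dec (IntervalCyclicColoring G t)
    colorableNonZero? =
      map′ (λ (_ , valid) → Valid⇒coloring valid)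
           (λ φ → encode (extend φ) , coloring⇒Valid φ λ u v e →
              trans (decode-encode (extend φ) u v) (extend-color φ u v e))
           (Fin.any? (valid? ∘ decode))

  colorable? : Decidable (IntervalCyclicColoring G)
  colorable? zero    = no λ φ → NonZero.nonZero (IntervalCyclicColoring.positive φ)
  colorable? (suc t) = colorableNonZero? (suc t)

  greatest-exists : ∀ {t} → IntervalCyclicColoring G t → ∃[ w ] (IsW-c G w × t ≤ w)
  greatest-exists {t} φ =
    let w , attained , greatest = bounded-max colorable? (order * order) colors-bounded (t , φ)
    in w , record { attained = attained ; greatest = greatest } , greatest t φ

-- Neighbors and degrees in the cube

-- The neighbor of u across coordinate i.
flip : ∀ {n} → Vec Bool n → Fin n → Vec Bool n
flip u i = updateAt u i not

flip-adjacent : ∀ {n} (u : Vec Bool n) i → DifferInExactlyOne u (flip u i)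
flip-adjacent u i =
  i , (λ eq → Bool.not-¬ refl (trans eq (lookup∘updateAt i u))) , only
  where
  only : ∀ {j} → Vec.lookup u j ≢ Vec.lookup (flip u i) j → i ≡ j
  only {j} d with i Fin.≟ j
  ... | yes i≡j = i≡j
  ... | no  i≢j = contradiction (sym (lookup∘updateAt′ j i (i≢j ∘ sym) u)) d

agree⇒≡ : ∀ {n} (u v : Vec Bool n) → (∀ j → Vec.lookup u j ≡ Vec.lookup v j) → u ≡ v
agree⇒≡ []      []      _  = refl
agree⇒≡ (a ∷ u) (b ∷ v) eq = cong₂ _∷_ (eq zero) (agree⇒≡ u v (eq ∘ suc))

adjacent⇒flip : ∀ {n} (u v : Vec Bool n) (e : DifferInExactlyOne u v) → v ≡ flip u (proj₁ e)
adjacent⇒flip u v (i , d , only) = agree⇒≡ v (flip u i) same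
  where
  same : ∀ j → Vec.lookup v j ≡ Vec.lookup (flip u i) j
  same j with i Fin.≟ j
  ... | yes refl = trans (Bool.¬-not (d ∘ sym)) (sym (lookup∘updateAt i u))
  ... | no  i≢j with Vec.lookup u j Bool.≟ Vec.lookup v j
  ...   | yes eq = trans (sym eq) (sym (lookup∘updateAt′ j i (i≢j ∘ sym) u))
  ...   | no  d′ = contradiction (only d′) i≢j

-- The first coordinate in which two vertices differ; the last coordinate if
-- they are equal.
direction : ∀ {n} → Vec Bool (suc n) → Vec Bool (suc n) → Fin (suc n)
direction {zero}  _       _       = zero
direction {suc n} (a ∷ u) (b ∷ v) with a Bool.≟ b
... | yes _ = suc (direction u v)
... | no  _ = zero

direction-flip : ∀ {n} (u : Vec Bool (suc n)) i → direction u (flip u i) ≡ i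
direction-flip {zero}  _           zero    = refl
direction-flip {suc n} (false ∷ u) zero    = refl
direction-flip {suc n} (true  ∷ u) zero    = refl
direction-flip {suc n} (false ∷ u) (suc i) = cong suc (direction-flip u i)
direction-flip {suc n} (true  ∷ u) (suc i) = cong suc (direction-flip u i)

direction-adjacent : ∀ {n} (u v : Vec Bool (suc n)) (e : DifferInExactlyOne u v) →
                     direction u v ≡ proj₁ e
direction-adjacent u v e =
  trans (cong (direction u) (adjacent⇒flip u v e)) (direction-flip u (proj₁ e))

flip-injective : ∀ {n} (u : Vec Bool n) {i j} → flip u i ≡ flip u j → i ≡ j
flip-injective {suc n} u {i} {j} eq =
  trans (sym (direction-flip u i)) (trans (cong (direction u) eq) (direction-flip u j))

-- The neighbors of v are exactly the n distinct vertices flip v i.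
degree-Q : ∀ n v → FiniteSimpleGraph.degree (Q n) v ≡ n
degree-Q n v = begin
  length (filter (differInExactlyOne? v) (cube n))
    ≡⟨ ↭-length (∼bag⇒↭ (unique∧set⇒bag
         (filter⁺ (differInExactlyOne? v) (cube-unique n))
         (map⁺ (flip-injective v) (allFin⁺ n))
         (mk⇔ to from))) ⟩
  length (map (flip v) (allFin n))  ≡⟨ length-map (flip v) (allFin n) ⟩
  length (allFin n)                 ≡⟨ length-tabulate {n = n} (λ i → i) ⟩
  n                                 ∎
  where
  open ≡-Reasoning
  to : ∀ {w} → w ∈ filter (differInExactlyOne? v) (cube n) → w ∈ map (flip v) (allFin n)
  to {w} w∈ with _ , e ← ∈-filter⁻ (differInExactlyOne? v) {xs = cube n} w∈ =
    subst (_∈ map (flip v) (allFin n)) (sym (adjacent⇒flip v w e))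
          (∈-map⁺ (flip v) (∈-allFin (proj₁ e)))

  from : ∀ {w} → w ∈ map (flip v) (allFin n) → w ∈ filter (differInExactlyOne? v) (cube n)
  from w∈ with i , _ , refl ← ∈-map⁻ (flip v) w∈ =
    ∈-filter⁺ (differInExactlyOne? v) (cube-complete (flip v i)) (flip-adjacent v i)

-- The coloring of the cube of dimension m + 2 with 4(m + 1) colors

module _ {m : ℕ} where

  -- The position of a vertex on the 4-cycle 00, 01, 11, 10 formed by the first
  -- two coordinates.
  position : Vec Bool (2 + m) → Fin 4
  position (false ∷ false ∷ _) = zero
  position (false ∷ true  ∷ _) = suc zero
  position (true  ∷ true  ∷ _) = suc (suc zero)
  position (true  ∷ false ∷ _) = suc (suc (suc zero))

  -- The parity of the position.  At an even position, coordinate 0 leads to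
  -- the preceding position and coordinate 1 to the next; at an odd position
  -- the roles are exchanged.
  parity : Vec Bool (2 + m) → Bool
  parity (a ∷ b ∷ _) = a xor b

  -- The last (true) or first (false) place of a window.
  end : Bool → Fin (2 + m)
  end false = zero
  end true  = fromℕ (suc m)

  -- The place, in the window of a vertex of the given parity, of the color of
  -- the edge in a given direction.
  rank : Bool → Fin (2 + m) → Fin (2 + m)
  rank p zero          = end p
  rank p (suc zero)    = end (not p)
  rank p (suc (suc i)) = suc (inject₁ i)

  rank-surjective : ∀ p k → ∃[ i ] rank p i ≡ k
  rank-surjective false zero = zero , refl
  rank-surjective true  zero = suc zero , refl
  rank-surjective p (suc k) with view k
  rank-surjective false _ | ‵fromℕ     = suc zero , refl
  rank-surjective true  _ | ‵fromℕ     = zero , refl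
  rank-surjective p     _ | ‵inject₁ i = suc (suc i) , refl

  end≢end-not : ∀ p → end p ≢ end (not p)
  end≢end-not false ()
  end≢end-not true  ()

  end≢inner : ∀ p {i} → end p ≢ suc (inject₁ i)
  end≢inner true eq = Fin.fromℕ≢inject₁ (Fin.suc-injective eq)

  rank-injective : ∀ p {i j} → rank p i ≡ rank p j → i ≡ j
  rank-injective p {zero}        {zero}        _  = refl
  rank-injective p {zero}        {suc zero}    eq = ⊥-elim (end≢end-not p eq)
  rank-injective p {zero}        {suc (suc _)} eq = ⊥-elim (end≢inner p eq)
  rank-injective p {suc zero}    {zero}        eq = ⊥-elim (end≢end-not p (sym eq))
  rank-injective p {suc zero}    {suc zero}    _  = refl
  rank-injective p {suc zero}    {suc (suc _)} eq = ⊥-elim (end≢inner (not p) eq)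
  rank-injective p {suc (suc _)} {zero}        eq = ⊥-elim (end≢inner p (sym eq))
  rank-injective p {suc (suc _)} {suc zero}    eq = ⊥-elim (end≢inner (not p) (sym eq))
  rank-injective p {suc (suc _)} {suc (suc _)} eq =
    cong (λ i → suc (suc i)) (Fin.inject₁-injective (Fin.suc-injective eq))

  -- The first color of the window of a vertex.
  start : Vec Bool (2 + m) → ℕ
  start u = suc m * toℕ (position u)

  -- The color, before reduction modulo 4(m + 1), of the edge that leaves u in
  -- direction i.
  colorNumber : Vec Bool (2 + m) → Fin (2 + m) → ℕ
  colorNumber u i = start u + toℕ (rank (parity u) i)

  window-step : ∀ q → (suc m * q + toℕ (end true)) % (4 * suc m)
                    ≡ (suc m * suc q + toℕ (end false)) % (4 * suc m)
  window-step q = cong (_% (4 * suc m)) (begin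
    suc m * q + toℕ (fromℕ (suc m))  ≡⟨ cong (suc m * q +_) (Fin.toℕ-fromℕ (suc m)) ⟩
    suc m * q + suc m                ≡⟨ distribute (suc m) q ⟩
    suc m * suc q + 0                ∎)
    where
    open ≡-Reasoning
    distribute : ∀ d q → d * q + d ≡ d * suc q + 0
    distribute = solve-∀

  window-wrap : (suc m * 3 + toℕ (end true)) % (4 * suc m)
              ≡ (suc m * 0 + toℕ (end false)) % (4 * suc m)
  window-wrap = begin
    (suc m * 3 + toℕ (end true)) % (4 * suc m)  ≡⟨ window-step 3 ⟩
    (suc m * 4 + 0) % (4 * suc m)               ≡⟨ cong (_% (4 * suc m)) (commute (suc m)) ⟩
    (suc m * 0 + 0 + 4 * suc m) % (4 * suc m)   ≡⟨ [m+n]%n≡m%n (suc m * 0 + 0) (4 * suc m) ⟩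
    (suc m * 0 + 0) % (4 * suc m)               ∎
    where
    open ≡-Reasoning
    commute : ∀ d → d * 4 + 0 ≡ d * 0 + 0 + 4 * d
    commute = solve-∀

  -- Only the cycle edges, in directions 0 and 1, join different windows; such
  -- an edge has the last color of one window and the first of the next.
  colorNumber-flip : ∀ u i → colorNumber u i % (4 * suc m) ≡ colorNumber (flip u i) i % (4 * suc m)
  colorNumber-flip (false ∷ false ∷ _) zero          = sym window-wrap
  colorNumber-flip (true  ∷ false ∷ _) zero          = window-wrap
  colorNumber-flip (false ∷ true  ∷ _) zero          = window-step 1
  colorNumber-flip (true  ∷ true  ∷ _) zero          = sym (window-step 1)
  colorNumber-flip (false ∷ false ∷ _) (suc zero)    = window-step 0
  colorNumber-flip (false ∷ true  ∷ _) (suc zero)    = sym (window-step 0)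
  colorNumber-flip (true  ∷ true  ∷ _) (suc zero)    = window-step 2
  colorNumber-flip (true  ∷ false ∷ _) (suc zero)    = sym (window-step 2)
  colorNumber-flip (false ∷ false ∷ _) (suc (suc _)) = refl
  colorNumber-flip (false ∷ true  ∷ _) (suc (suc _)) = refl
  colorNumber-flip (true  ∷ true  ∷ _) (suc (suc _)) = refl
  colorNumber-flip (true  ∷ false ∷ _) (suc (suc _)) = refl

  position-surjective : ∀ q → ∃[ u ] position u ≡ q
  position-surjective zero                   = false ∷ false ∷ Vec.replicate m false , refl
  position-surjective (suc zero)             = false ∷ true  ∷ Vec.replicate m false , refl
  position-surjective (suc (suc zero))       = true  ∷ true  ∷ Vec.replicate m false , refl
  position-surjective (suc (suc (suc zero))) = true  ∷ false ∷ Vec.replicate m false , refl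

  -- The color of the edge that leaves u in direction i.
  edgeColor : Vec Bool (2 + m) → Fin (2 + m) → Fin (4 * suc m)
  edgeColor u i = colorNumber u i mod (4 * suc m)

  edgeColor-toℕ : ∀ u i → toℕ (edgeColor u i) ≡ colorNumber u i % (4 * suc m)
  edgeColor-toℕ u i = toℕ-mod (colorNumber u i) (4 * suc m)

  edgeColor-flip : ∀ u i → edgeColor u i ≡ edgeColor (flip u i) i
  edgeColor-flip u i = Fin.toℕ-injective
    (trans (edgeColor-toℕ u i)
      (trans (colorNumber-flip u i) (sym (edgeColor-toℕ (flip u i) i))))

  window-fits : 2 + m ≤ 4 * suc m
  window-fits = subst (2 + m ≤_) (expand m) (ℕ.m≤m+n (2 + m) (2 + 3 * m))
    where
    expand : ∀ m → 2 + m + (2 + 3 * m) ≡ 4 * suc m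
    expand = solve-∀

  edgeColor-injective : ∀ u {i j} → edgeColor u i ≡ edgeColor u j → i ≡ j
  edgeColor-injective u {i} {j} eq = rank-injective (parity u) {i} {j} (Fin.toℕ-injective
    (shift-injective (start u) (4 * suc m) (rank<t i) (rank<t j)
      (trans (sym (edgeColor-toℕ u i)) (trans (cong toℕ eq) (edgeColor-toℕ u j)))))
    where
    rank<t : ∀ i → toℕ (rank (parity u) i) < 4 * suc m
    rank<t i = ℕ.<-≤-trans (Fin.toℕ<n (rank (parity u) i)) window-fits

  edgeColor-window : ∀ u {r} → r < 2 + m →
                     ∃[ i ] toℕ (edgeColor u i) ≡ (start u + r) % (4 * suc m)
  edgeColor-window u {r} r< =
    let i , eq = rank-surjective (parity u) (fromℕ< r<)
    in i , trans (edgeColor-toℕ u i)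
             (cong (λ s → (start u + s) % (4 * suc m))
               (trans (cong toℕ eq) (Fin.toℕ-fromℕ< r<)))

  -- The color number (m + 1)q + r with r at most m is the one of rank r at a
  -- vertex in position q.
  edgeColor-surjective : ∀ k → ∃[ u ] ∃[ i ] edgeColor u i ≡ k
  edgeColor-surjective k = u , i , Fin.toℕ-injective (begin
    toℕ (edgeColor u i)                           ≡⟨ at-i ⟩
    (start u + toℕ r) % (4 * suc m)               ≡⟨ cong (_% (4 * suc m)) split ⟩
    toℕ k % (4 * suc m)                           ≡⟨ m<n⇒m%n≡m (Fin.toℕ<n k) ⟩
    toℕ k                                         ∎)
    where
    open ≡-Reasoning
    q = proj₁ (remQuot {4} (suc m) k)
    r = proj₂ (remQuot {4} (suc m) k)
    u = proj₁ (position-surjective q)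

    at-rank : ∃[ i ] toℕ (edgeColor u i) ≡ (start u + toℕ r) % (4 * suc m)
    at-rank = edgeColor-window u (ℕ.m≤n⇒m≤1+n (Fin.toℕ<n r))

    i = proj₁ at-rank
    at-i = proj₂ at-rank

    split : start u + toℕ r ≡ toℕ k
    split = begin
      start u + toℕ r          ≡⟨ cong (λ p → suc m * toℕ p + toℕ r) (proj₂ (position-surjective q)) ⟩
      suc m * toℕ q + toℕ r    ≡⟨ Fin.toℕ-combine q r ⟨
      toℕ (combine q r)        ≡⟨ cong toℕ (Fin.combine-remQuot {4} (suc m) k) ⟩
      toℕ k                    ∎

-- The color of an edge is read off its two ends alone, the adjacency proof being
-- irrelevant; this is why direction is defined for all pairs of vertices.
cubeColoring : ∀ m → IntervalCyclicColoring (Q (2 + m)) (4 * suc m)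
cubeColoring m = record
  { color       = λ u v _ → edgeColor u (direction u v)
  ; color-sym   = λ {u} {v} → symmetric u v
  ; proper      = λ {u} {v} {w} e f v≢w eq →
                  v≢w (neighbor-unique u v w e f (edgeColor-injective u eq))
  ; allUsed     = λ k → let u , i , eq = edgeColor-surjective k in
                  u , flip u i , flip-adjacent u i ,
                  trans (cong (edgeColor u) (direction-flip u i)) eq
  ; consecutive = λ v → start v , λ k → mk⇔ (into v) (onto v k)
  }
  where
  open FiniteSimpleGraph (Q (2 + m)) using (Adj; adj-sym; degree)

  symmetric : ∀ u v → Adj u v → edgeColor u (direction u v) ≡ edgeColor v (direction v u)
  symmetric u v e = begin
    edgeColor u (direction u v)             ≡⟨ cong (edgeColor u) (direction-adjacent u v e) ⟩
    edgeColor u (proj₁ e)                   ≡⟨ edgeColor-flip u (proj₁ e) ⟩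
    edgeColor (flip u (proj₁ e)) (proj₁ e)  ≡⟨ cong (λ w → edgeColor w (proj₁ e)) (adjacent⇒flip u v e) ⟨
    edgeColor v (proj₁ e)                   ≡⟨ cong (edgeColor v) (direction-adjacent v u (adj-sym {u} {v} e)) ⟨
    edgeColor v (direction v u)             ∎
    where open ≡-Reasoning

  neighbor-unique : ∀ u v w → Adj u v → Adj u w → direction u v ≡ direction u w → v ≡ w
  neighbor-unique u v w e f eq =
    trans (adjacent⇒flip u v e)
      (trans (cong (flip u) (trans (sym (direction-adjacent u v e)) (trans eq (direction-adjacent u w f))))
        (sym (adjacent⇒flip u w f)))

  into : ∀ v {k} → ∃[ w ] Σ[ e ∈ Adj v w ] edgeColor v (direction v w) ≡ k →
         ∃[ r ] (r < degree v × toℕ k ≡ (start v + r) % (4 * suc m))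
  into v (w , _ , refl) =
    toℕ (rank (parity v) i) ,
    subst (toℕ (rank (parity v) i) <_) (sym (degree-Q (2 + m) v)) (Fin.toℕ<n (rank (parity v) i)) ,
    edgeColor-toℕ v i
    where i = direction v w

  onto : ∀ v k → ∃[ r ] (r < degree v × toℕ k ≡ (start v + r) % (4 * suc m)) →
         ∃[ w ] Σ[ e ∈ Adj v w ] edgeColor v (direction v w) ≡ k
  onto v k (r , r< , k≡) =
    let i , eq = edgeColor-window v (subst (r <_) (degree-Q (2 + m) v) r<)
    in flip v i , flip-adjacent v i ,
       trans (cong (edgeColor v) (direction-flip v i)) (Fin.toℕ-injective (trans eq (sym k≡)))

theorem33 : ∀ (n : ℕ) → 2 ≤ n → ∃[ w ] (IsW-c (Q n) w × 4 * (n ∸ 1) ≤ w)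
theorem33 (suc (suc m)) _ = greatest-exists (Q (2 + m)) (cubeColoring m)
theorem33 (suc zero) (s≤s ())
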